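{- Let $l=\sum_{i=1}^k c_iH_i$ be an element of $\mathbb{G}$ (with $c_i\in\mathbb{C}$) such that each $H_i$ is a graph with vertex set $[n]$ for some positive integer $n$. Then $l$ is a modular relation for $X$ if and only if for every set partition $\pi$ of $[n]$, $$C(l;\pi)=\sum_{i=1}^k c_i\,\delta_{e_{H_i}(\pi),0}=0,$$ where $e_{H_i}(\pi)$ is the number of edges of $H_i$ (counted with multiplicity) with both endpoints in the same block of $\pi$ and $\delta$ is the Kronecker delta.
   Context: Write $[n]=\{1,\dots,n\}$. A graph is a finite vertex set $V(G)$ together with a finite multiset $E(G)$ of unordered pairs of not necessarily distinct vertices (loops and multi-edges are allowed). $\mathbb{G}$ is the $\mathbb{C}$-vector space freely generated by all (labelled) graphs whose vertex set is $[n]$ for some $n\ge 1$. Chromatic symmetric function: for a graph $G$, $X_G(x_1,x_2,\dots)=\sum_{\kappa}\prod_{v\in V(G)}x_{\kappa(v)}$, where the sum is over all proper colorings, i.e. maps $\kappa:V(G)\to\{1,2,3,\dots\}$ with $\kappa(v_1)\ne\kappa(v_2)$ whenever $v_1v_2\in E(G)$ (so $X_G=0$ if $G$ has a loop). It takes values in the algebra $\Lambda$ of symmetric functions over $\mathbb{C}$; extend linearly to $X:\mathbb{G}\to\Lambda$, with kernel $Ker(X)$. Extension: for a graph $G$ and a multiset $E$ of edges with endpoints in $V(G)$, $G\uplus E$ is the graph with vertex set $V(G)$ and edge multiset $E(G)\uplus E$ (multiplicities are added). For $l=\sum_i c_iH_i$ with all $H_i$ graphs on $[n]$ and a graph $G$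 on $[N]$, $N\ge n$, set $Ext(l;G)=\sum_i c_i\,(G\uplus E(H_i))$. Modular relation: a linear combination $l\in\mathbb{G}$ of graphs with vertex set $[n]$ is a modular relation for $X$ if $Ext(l;G)\in Ker(X)$ for every $N\ge n$ and every graph $G$ with vertex set $[N]$. -}

module Defs where

open import Algebra.Bundles using (CommutativeMonoid; CommutativeRing)
open import Algebra.Structures using (IsCommutativeRing)
open import Data.Bool using (if_then_else_)
open import Data.Fin using (Fin; finToFun; inject≤)
import Data.Fin.Properties as Fin
open import Data.Fin.Subset using (Subset; _∈_; _∩_; Nonempty; Empty)
open import Data.Fin.Subset.Properties using (_∈?_)
open import Data.List using (List; []; _∷_; _++_; allFin; filter; foldr; length; map)
open import Data.List.Relation.Unary.All as All using (All)
open import Data.List.Relation.Unary.AllPairs using (AllPairs)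
open import Data.List.Relation.Unary.Any as Any using (Any)
open import Data.Nat as ℕ using (ℕ; NonZero)
import Data.Nat.Properties as ℕ
open import Data.Product using (_×_; _,_; ∃; map₂; proj₁; proj₂)
open import Data.Rational as ℚ using (ℚ; 0ℚ; 1ℚ; ½; ∣_∣; Positive)
import Data.Rational.Properties as ℚ
open import Data.Vec.Functional using (Vector)
open import Function using (_∘_)
open import Level using (0ℓ)
open import Relation.Binary.PropositionalEquality as ≡
  using (_≡_; _≢_; _≗_; refl; sym; trans; cong; cong₂; subst)
open import Relation.Nullary using (Dec; does; ¬?; _×-dec_)

private
  module RingIdentities (R : CommutativeRing 0ℓ 0ℓ) where
    open CommutativeRing R renaming (sym to ≈-sym; trans to ≈-trans)
    open import Algebra.Properties.AbelianGroup +-abelianGroup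
      using (xyx⁻¹≈y; ⁻¹-anti-homo-//; //-rightDividesˡ; ⁻¹-∙-comm)
    open import Algebra.Properties.CommutativeSemigroup
      (CommutativeMonoid.commutativeSemigroup +-commutativeMonoid) using (interchange)
    open import Algebra.Properties.Ring ring using (x[y-z]≈xy-xz; [y-z]x≈yx-zx)
    open import Relation.Binary.Reasoning.Setoid setoid

    split : ∀ a b → b + (a - b) ≈ a
    split a b = ≈-trans (≈-sym (+-assoc b a (- b))) (xyx⁻¹≈y b a)

    swap : ∀ a b → - (a - b) ≈ b - a
    swap = ⁻¹-anti-homo-//

    telescope : ∀ a b c → (a - b) + (b - c) ≈ a - c
    telescope a b c =
      ≈-trans (≈-sym (+-assoc (a - b) b (- c))) (+-congʳ (//-rightDividesˡ b a))

    product : ∀ a b c d → a * (b - d) + d * (a - c) ≈ a * b - c * d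
    product a b c d = ≈-trans
      (+-cong (x[y-z]≈xy-xz a b d) (≈-trans (*-comm d (a - c)) ([y-z]x≈yx-zx d a c)))
      (telescope (a * b) (a * d) (c * d))

    sum : ∀ a b c d → (a - c) + (b - d) ≈ (a + b) - (c + d)
    sum a b c d = ≈-trans (interchange a (- c) b (- d)) (+-congˡ (⁻¹-∙-comm c d))

    negation : ∀ a b → - (a - b) ≈ - a - - b
    negation a b = ≈-sym (⁻¹-∙-comm a (- b))

    *-assoc-re : ∀ a b c d e f →
      (a * c - b * d) * e - (a * d + b * c) * f ≈ a * (c * e - d * f) - b * (c * f + d * e)
    *-assoc-re a b c d e f = begin
      (a * c - b * d) * e - (a * d + b * c) * f
        ≈⟨ +-cong ([y-z]x≈yx-zx e (a * c) (b * d)) (-‿cong (distribʳ f (a * d) (b * c))) ⟩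
      (a * c * e - b * d * e) - (a * d * f + b * c * f)
        ≈⟨ +-cong (+-cong (*-assoc a c e) (-‿cong (*-assoc b d e)))
                  (-‿cong (+-cong (*-assoc a d f) (*-assoc b c f))) ⟩
      (a * (c * e) - b * (d * e)) - (a * (d * f) + b * (c * f))
        ≈⟨ +-congˡ (⁻¹-∙-comm _ _) ⟨
      (a * (c * e) - b * (d * e)) + (- (a * (d * f)) - b * (c * f))
        ≈⟨ interchange _ _ _ _ ⟩
      (a * (c * e) - a * (d * f)) + (- (b * (d * e)) - b * (c * f))
        ≈⟨ +-congˡ (≈-trans (+-comm _ _) (⁻¹-∙-comm _ _)) ⟩
      (a * (c * e) - a * (d * f)) - (b * (c * f) + b * (d * e))
        ≈⟨ +-cong (x[y-z]≈xy-xz a (c * e) (d * f)) (-‿cong (distribˡ b (c * f) (d * e))) ⟨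
      a * (c * e - d * f) - b * (c * f + d * e) ∎

    *-assoc-im : ∀ a b c d e f →
      (a * c - b * d) * f + (a * d + b * c) * e ≈ a * (c * f + d * e) + b * (c * e - d * f)
    *-assoc-im a b c d e f = begin
      (a * c - b * d) * f + (a * d + b * c) * e
        ≈⟨ +-cong ([y-z]x≈yx-zx f (a * c) (b * d)) (distribʳ e (a * d) (b * c)) ⟩
      (a * c * f - b * d * f) + (a * d * e + b * c * e)
        ≈⟨ +-cong (+-cong (*-assoc a c f) (-‿cong (*-assoc b d f)))
                  (+-cong (*-assoc a d e) (*-assoc b c e)) ⟩
      (a * (c * f) - b * (d * f)) + (a * (d * e) + b * (c * e))
        ≈⟨ interchange _ _ _ _ ⟩
      (a * (c * f) + a * (d * e)) + (- (b * (d * f)) + b * (c * e))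
        ≈⟨ +-congˡ (+-comm _ _) ⟩
      (a * (c * f) + a * (d * e)) + (b * (c * e) - b * (d * f))
        ≈⟨ +-cong (distribˡ a (c * f) (d * e)) (x[y-z]≈xy-xz b (c * e) (d * f)) ⟨
      a * (c * f + d * e) + b * (c * e - d * f) ∎

    distribˡ-re : ∀ a b c d e f →
      a * (c + e) - b * (d + f) ≈ (a * c - b * d) + (a * e - b * f)
    distribˡ-re a b c d e f = ≈-trans
      (+-cong (distribˡ a c e) (-‿cong (distribˡ b d f)))
      (≈-sym (sum (a * c) (a * e) (b * d) (b * f)))

    distribˡ-im : ∀ a b c d e f →
      a * (d + f) + b * (c + e) ≈ (a * d + b * c) + (a * f + b * e)
    distribˡ-im a b c d e f = ≈-trans
      (+-cong (distribˡ a d f) (distribˡ b c e)) (interchange _ _ _ _)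

  module ℚ-ring = RingIdentities ℚ.+-*-commutativeRing

-- `a ≽ N` says that the index a lies beyond stage N.  Two index types are
-- used: ℕ, for convergence to 0, and ℕ × ℕ, for the Cauchy condition.

module Vanishing {A : Set} (_≽_ : A → ℕ → Set)
  (weaken : ∀ {a M N} → M ℕ.≤ N → a ≽ N → a ≽ M) where

  Null : (A → ℚ) → Set
  Null f = ∀ ε → .{{Positive ε}} → ∃ λ N → ∀ {a} → a ≽ N → ∣ f a ∣ ℚ.< ε

  Bounded : (A → ℚ) → Set
  Bounded f = ∃ λ B → Positive B × ∃ λ N → ∀ {a} → a ≽ N → ∣ f a ∣ ℚ.≤ B

  null-cong : ∀ {f g} → f ≗ g → Null f → Null g
  null-cong f≗g f0 ε with f0 ε
  ... | N , f<ε = N , λ {a} a≽N → subst (λ q → ∣ q ∣ ℚ.< ε) (f≗g a) (f<ε a≽N)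

  null-0 : Null (λ _ → 0ℚ)
  null-0 ε = 0 , λ _ → ℚ.positive⁻¹ ε

  null-neg : ∀ {f} → Null f → Null (ℚ.-_ ∘ f)
  null-neg {f} f0 ε with f0 ε
  ... | N , f<ε = N , λ {a} a≽N →
    subst (ℚ._< ε) (sym (ℚ.∣-p∣≡∣p∣ (f a))) (f<ε a≽N)

  null-+ : ∀ {f g} → Null f → Null g → Null (λ a → f a ℚ.+ g a)
  null-+ {f} {g} f0 g0 ε
    with f0 (½ ℚ.* ε) {{ℚ.pos*pos⇒pos ½ ε}} | g0 (½ ℚ.* ε) {{ℚ.pos*pos⇒pos ½ ε}}
  ... | M , f< | N , g< = M ℕ.⊔ N , λ {a} a≽ → begin-strict
      ∣ f a ℚ.+ g a ∣         ≤⟨ ℚ.∣p+q∣≤∣p∣+∣q∣ (f a) (g a) ⟩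
      ∣ f a ∣ ℚ.+ ∣ g a ∣     <⟨ ℚ.+-mono-< (f< (weaken (ℕ.m≤m⊔n M N) a≽))
                                            (g< (weaken (ℕ.m≤n⊔m M N) a≽)) ⟩
      ½ ℚ.* ε ℚ.+ ½ ℚ.* ε     ≡⟨ sym (ℚ.*-distribʳ-+ ε ½ ½) ⟩
      1ℚ ℚ.* ε                ≡⟨ ℚ.*-identityˡ ε ⟩
      ε                       ∎
    where open ℚ.≤-Reasoning

  null-* : ∀ {f g} → Bounded f → Null g → Null (λ a → f a ℚ.* g a)
  null-* {f} {g} (B , B>0 , M , f≤) g0 ε = M ℕ.⊔ N , λ {a} a≽ → begin-strict
      ∣ f a ℚ.* g a ∣         ≡⟨ ℚ.∣p*q∣≡∣p∣*∣q∣ (f a) (g a) ⟩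
      ∣ f a ∣ ℚ.* ∣ g a ∣     ≤⟨ ℚ.*-monoʳ-≤-nonNeg ∣ g a ∣ {{ℚ.∣-∣-nonNeg (g a)}}
                                   (f≤ (weaken (ℕ.m≤m⊔n M N) a≽)) ⟩
      B ℚ.* ∣ g a ∣           <⟨ ℚ.*-monoʳ-<-pos B (g< (weaken (ℕ.m≤n⊔m M N) a≽)) ⟩
      B ℚ.* δ                 ≡⟨ sym (ℚ.*-assoc B B⁻¹ ε) ⟩
      (B ℚ.* B⁻¹) ℚ.* ε       ≡⟨ cong (ℚ._* ε) (ℚ.*-inverseʳ B) ⟩
      1ℚ ℚ.* ε                ≡⟨ ℚ.*-identityˡ ε ⟩
      ε                       ∎
    where
    open ℚ.≤-Reasoning
    instance
      _ = B>0
      B≢0 = ℚ.pos⇒nonZero B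
    B⁻¹ = ℚ.1/ B
    δ = B⁻¹ ℚ.* ε
    δ>0 : Positive δ
    δ>0 = ℚ.pos*pos⇒pos B⁻¹ {{ℚ.1/pos⇒pos B}} ε
    N = proj₁ (g0 δ {{δ>0}})
    g< : ∀ {a} → a ≽ N → ∣ g a ∣ ℚ.< δ
    g< = proj₂ (g0 δ {{δ>0}})

module Seq = Vanishing {ℕ} ℕ._≥_ (λ M≤N N≤a → ℕ.≤-trans M≤N N≤a)
module Seq² = Vanishing {ℕ × ℕ} (λ (m , n) N → m ℕ.≥ N × n ℕ.≥ N)
  (λ M≤N (N≤a , N≤b) → ℕ.≤-trans M≤N N≤a , ℕ.≤-trans M≤N N≤b)

-- ℝ is the Cauchy completion of ℚ: Cauchy sequences, equal when their difference
-- tends to 0.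

Cauchy : (ℕ → ℚ) → Set
Cauchy x = Seq².Null (λ (m , n) → x m ℚ.- x n)

record ℝ : Set where
  constructor mkℝ
  field
    seq    : ℕ → ℚ
    cauchy : Cauchy seq

open ℝ

infix 4 _≈ℝ_

record _≈ℝ_ (x y : ℝ) : Set where
  constructor mk≈
  field difference-null : Seq.Null (λ n → seq x n ℚ.- seq y n)

open _≈ℝ_

bounded : ∀ x → Seq.Bounded (seq x)
bounded (mkℝ x cx) with cx 1ℚ
... | N , x<1 = ∣ x N ∣ ℚ.+ 1ℚ , ℚ.nonNeg+pos⇒pos ∣ x N ∣ {{ℚ.∣-∣-nonNeg (x N)}} 1ℚ , N ,
  λ {n} n≥N → begin
    ∣ x n ∣                          ≡⟨ cong ∣_∣ (sym (ℚ-ring.split (x n) (x N))) ⟩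
    ∣ x N ℚ.+ (x n ℚ.- x N) ∣        ≤⟨ ℚ.∣p+q∣≤∣p∣+∣q∣ (x N) (x n ℚ.- x N) ⟩
    ∣ x N ∣ ℚ.+ ∣ x n ℚ.- x N ∣      ≤⟨ ℚ.+-monoʳ-≤ ∣ x N ∣ (ℚ.<⇒≤ (x<1 (n≥N , ℕ.≤-refl))) ⟩
    ∣ x N ∣ ℚ.+ 1ℚ                   ∎
  where open ℚ.≤-Reasoning

private
  bounded₁ : ∀ x → Seq².Bounded (λ (m , n) → seq x m)
  bounded₁ x with bounded x
  ... | B , B>0 , N , x≤B = B , B>0 , N , x≤B ∘ proj₁

  bounded₂ : ∀ x → Seq².Bounded (λ (m , n) → seq x n)
  bounded₂ x with bounded x
  ... | B , B>0 , N , x≤B = B , B>0 , N , x≤B ∘ proj₂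

fromℚ : ℚ → ℝ
fromℚ q = mkℝ (λ _ → q) (Seq².null-cong (λ _ → sym (ℚ.+-inverseʳ q)) Seq².null-0)

infixl 6 _+ℝ_
infixl 7 _*ℝ_

_+ℝ_ : ℝ → ℝ → ℝ
x +ℝ y = mkℝ (λ n → seq x n ℚ.+ seq y n) (Seq².null-cong
  (λ (m , n) → ℚ-ring.sum (seq x m) (seq y m) (seq x n) (seq y n))
  (Seq².null-+ (cauchy x) (cauchy y)))

_*ℝ_ : ℝ → ℝ → ℝ
x *ℝ y = mkℝ (λ n → seq x n ℚ.* seq y n) (Seq².null-cong
  (λ (m , n) → ℚ-ring.product (seq x m) (seq y m) (seq x n) (seq y n))
  (Seq².null-+ (Seq².null-* (bounded₁ x) (cauchy y)) (Seq².null-* (bounded₂ y) (cauchy x))))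

-ℝ_ : ℝ → ℝ
-ℝ x = mkℝ (λ n → ℚ.- seq x n) (Seq².null-cong
  (λ (m , n) → ℚ-ring.negation (seq x m) (seq x n)) (Seq².null-neg (cauchy x)))

private
  pointwise : ∀ {x y} → seq x ≗ seq y → x ≈ℝ y
  pointwise {x} {y} x≗y = mk≈ (Seq.null-cong
    (λ n → trans (sym (ℚ.+-inverseʳ (seq y n))) (cong (ℚ._- seq y n) (sym (x≗y n))))
    Seq.null-0)

  ≈ℝ-sym : ∀ {x y} → x ≈ℝ y → y ≈ℝ x
  ≈ℝ-sym {x} {y} (mk≈ p) = mk≈ (Seq.null-cong (λ n → ℚ-ring.swap (seq x n) (seq y n)) (Seq.null-neg p))

  ≈ℝ-trans : ∀ {x y z} → x ≈ℝ y → y ≈ℝ z → x ≈ℝ z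
  ≈ℝ-trans {x} {y} {z} (mk≈ p) (mk≈ q) =
    mk≈ (Seq.null-cong (λ n → ℚ-ring.telescope (seq x n) (seq y n) (seq z n)) (Seq.null-+ p q))

  +ℝ-cong : ∀ {x y u v} → x ≈ℝ y → u ≈ℝ v → x +ℝ u ≈ℝ y +ℝ v
  +ℝ-cong {x} {y} {u} {v} (mk≈ p) (mk≈ q) = mk≈ (Seq.null-cong
    (λ n → ℚ-ring.sum (seq x n) (seq u n) (seq y n) (seq v n)) (Seq.null-+ p q))

  *ℝ-cong : ∀ {x y u v} → x ≈ℝ y → u ≈ℝ v → x *ℝ u ≈ℝ y *ℝ v
  *ℝ-cong {x} {y} {u} {v} (mk≈ p) (mk≈ q) = mk≈ (Seq.null-cong
    (λ n → ℚ-ring.product (seq x n) (seq u n) (seq y n) (seq v n))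
    (Seq.null-+ (Seq.null-* (bounded x) q) (Seq.null-* (bounded v) p)))

  -ℝ-cong : ∀ {x y} → x ≈ℝ y → -ℝ x ≈ℝ -ℝ y
  -ℝ-cong {x} {y} (mk≈ p) = mk≈ (Seq.null-cong
    (λ n → ℚ-ring.negation (seq x n) (seq y n)) (Seq.null-neg p))

ℝ-isCommutativeRing : IsCommutativeRing _≈ℝ_ _+ℝ_ _*ℝ_ -ℝ_ (fromℚ 0ℚ) (fromℚ 1ℚ)
ℝ-isCommutativeRing = record
  { isRing = record
    { +-isAbelianGroup = record
      { isGroup = record
        { isMonoid = record
          { isSemigroup = record
            { isMagma = record
              { isEquivalence = record
                { refl  = pointwise λ _ → refl
                ; sym   = ≈ℝ-sym
                ; trans = ≈ℝ-trans
                }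
              ; ∙-cong = +ℝ-cong
              }
            ; assoc = λ x y z → pointwise λ n → ℚ.+-assoc (seq x n) (seq y n) (seq z n)
            }
          ; identity = (λ x → pointwise λ n → ℚ.+-identityˡ (seq x n))
                     , (λ x → pointwise λ n → ℚ.+-identityʳ (seq x n))
          }
        ; inverse = (λ x → pointwise λ n → ℚ.+-inverseˡ (seq x n))
                  , (λ x → pointwise λ n → ℚ.+-inverseʳ (seq x n))
        ; ⁻¹-cong = -ℝ-cong
        }
      ; comm = λ x y → pointwise λ n → ℚ.+-comm (seq x n) (seq y n)
      }
    ; *-cong = *ℝ-cong
    ; *-assoc = λ x y z → pointwise λ n → ℚ.*-assoc (seq x n) (seq y n) (seq z n)
    ; *-identity = (λ x → pointwise λ n → ℚ.*-identityˡ (seq x n))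
                 , (λ x → pointwise λ n → ℚ.*-identityʳ (seq x n))
    ; distrib = (λ x y z → pointwise λ n → ℚ.*-distribˡ-+ (seq x n) (seq y n) (seq z n))
              , (λ x y z → pointwise λ n → ℚ.*-distribʳ-+ (seq x n) (seq y n) (seq z n))
    }
  ; *-comm = λ x y → pointwise λ n → ℚ.*-comm (seq x n) (seq y n)
  }

ℝ-commutativeRing : CommutativeRing 0ℓ 0ℓ
ℝ-commutativeRing = record { isCommutativeRing = ℝ-isCommutativeRing }

record Complexified (A : Set) : Set where
  constructor _+i_
  field re im : A

open Complexified

module Complexification (R : CommutativeRing 0ℓ 0ℓ) where

  private
    open module R = CommutativeRing R
      using (_≈_; _+_; _*_; -_; _-_; 0#; 1#)
    open RingIdentities R
    open import Algebra.Properties.Ring R.ring using (-0#≈0#)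

  Carrier : Set
  Carrier = Complexified R.Carrier

  record _≋_ (z w : Carrier) : Set where
    constructor _+i_
    field
      re≈ : re z ≈ re w
      im≈ : im z ≈ im w

  _⊕_ _⊛_ : Carrier → Carrier → Carrier
  (a +i b) ⊕ (c +i d) = (a + c) +i (b + d)
  (a +i b) ⊛ (c +i d) = (a * c - b * d) +i (a * d + b * c)

  ⊖_ : Carrier → Carrier
  ⊖ (a +i b) = (- a) +i (- b)

  private
    ≋-trans : ∀ {x y z} → x ≋ y → y ≋ z → x ≋ z
    ≋-trans (p +i q) (r +i s) = R.trans p r +i R.trans q s

    ⊕-cong : ∀ {x y u v} → x ≋ y → u ≋ v → (x ⊕ u) ≋ (y ⊕ v)
    ⊕-cong (p +i q) (r +i s) = R.+-cong p r +i R.+-cong q s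

    ⊛-cong : ∀ {x y u v} → x ≋ y → u ≋ v → (x ⊛ u) ≋ (y ⊛ v)
    ⊛-cong (p +i q) (r +i s) =
      R.+-cong (R.*-cong p r) (R.-‿cong (R.*-cong q s)) +i
      R.+-cong (R.*-cong p s) (R.*-cong q r)

    ⊛-comm : ∀ x y → (x ⊛ y) ≋ (y ⊛ x)
    ⊛-comm (a +i b) (c +i d) =
      R.+-cong (R.*-comm a c) (R.-‿cong (R.*-comm b d)) +i
      R.trans (R.+-comm (a * d) (b * c)) (R.+-cong (R.*-comm b c) (R.*-comm a d))

    ⊛-identityˡ : ∀ x → ((1# +i 0#) ⊛ x) ≋ x
    ⊛-identityˡ (a +i b) =
      R.trans (R.+-cong (R.*-identityˡ a) (R.trans (R.-‿cong (R.zeroˡ b)) -0#≈0#)) (R.+-identityʳ a) +i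
      R.trans (R.+-cong (R.*-identityˡ b) (R.zeroˡ a)) (R.+-identityʳ b)

    ⊛-distribˡ : ∀ x y z → (x ⊛ (y ⊕ z)) ≋ ((x ⊛ y) ⊕ (x ⊛ z))
    ⊛-distribˡ (a +i b) (c +i d) (e +i f) =
      distribˡ-re a b c d e f +i distribˡ-im a b c d e f

  isCommutativeRing : IsCommutativeRing _≋_ _⊕_ _⊛_ ⊖_ (0# +i 0#) (1# +i 0#)
  isCommutativeRing = record
    { isRing = record
      { +-isAbelianGroup = record
        { isGroup = record
          { isMonoid = record
            { isSemigroup = record
              { isMagma = record
                { isEquivalence = record
                  { refl  = R.refl +i R.refl
                  ; sym   = λ (p +i q) → R.sym p +i R.sym q
                  ; trans = ≋-trans
                  }
                ; ∙-cong = ⊕-cong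
                }
              ; assoc = λ x y z → R.+-assoc _ _ _ +i R.+-assoc _ _ _
              }
            ; identity = (λ _ → R.+-identityˡ _ +i R.+-identityˡ _)
                       , (λ _ → R.+-identityʳ _ +i R.+-identityʳ _)
            }
          ; inverse = (λ _ → R.-‿inverseˡ _ +i R.-‿inverseˡ _)
                    , (λ _ → R.-‿inverseʳ _ +i R.-‿inverseʳ _)
          ; ⁻¹-cong = λ (p +i q) → R.-‿cong p +i R.-‿cong q
          }
        ; comm = λ _ _ → R.+-comm _ _ +i R.+-comm _ _
        }
      ; *-cong = ⊛-cong
      ; *-assoc = λ (a +i b) (c +i d) (e +i f) →
          *-assoc-re a b c d e f +i *-assoc-im a b c d e f
      ; *-identity = ⊛-identityˡ
                   , (λ x → ≋-trans (⊛-comm x _) (⊛-identityˡ x))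
      ; distrib = ⊛-distribˡ
                , (λ x y z → ≋-trans (⊛-comm (y ⊕ z) x) (≋-trans (⊛-distribˡ x y z)
                    (⊕-cong (⊛-comm x y) (⊛-comm x z))))
      }
    ; *-comm = ⊛-comm
    }

  commutativeRing : CommutativeRing 0ℓ 0ℓ
  commutativeRing = record { isCommutativeRing = isCommutativeRing }

ℂ-commutativeRing : CommutativeRing 0ℓ 0ℓ
ℂ-commutativeRing = Complexification.commutativeRing ℝ-commutativeRing

open CommutativeRing ℂ-commutativeRing public
  using (_≈_; _+_; _*_)
  renaming (Carrier to ℂ; 0# to 0ℂ; 1# to 1ℂ)

open import Algebra.Definitions.RawMonoid (CommutativeRing.+-rawMonoid ℂ-commutativeRing) public
  using () renaming (_×_ to _·_)

fromℕ : ℕ → ℂ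
fromℕ k = k · 1ℂ

δ : ℕ → ℕ → ℂ
δ a b = if does (a ℕ.≟ b) then 1ℂ else 0ℂ

-- The list stands for a finite multiset of unordered pairs: everything
-- below is insensitive to the order of the list and to the orientation
-- of each pair.

EdgeMultiset : ℕ → Set
EdgeMultiset n = List (Fin n × Fin n)

record Graph (n : ℕ) : Set where
  constructor graph
  field E : EdgeMultiset n

open Graph public

infixl 6 _⊎ᴱ_

_⊎ᴱ_ : ∀ {n} → Graph n → EdgeMultiset n → Graph n
G ⊎ᴱ F = graph (E G ++ F)

includeEdges : ∀ {n N} → n ℕ.≤ N → EdgeMultiset n → EdgeMultiset N
includeEdges n≤N = map λ (u , v) → inject≤ u n≤N , inject≤ v n≤N

-- A formal sum Σ cᵢ aᵢ; the aᵢ need not be distinct.  Different formal sums may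
-- present the same vector of the free ℂ-vector space.  The functions on formal
-- sums below are linear in the cᵢ, so they do not depend on the presentation.

FormalSum : Set → Set
FormalSum A = List (ℂ × A)

linearExtension : ∀ {A} → (A → ℂ) → FormalSum A → ℂ
linearExtension f = foldr (λ (c , a) s → c * f a + s) 0ℂ

record LabelledGraph : Set where
  constructor labelled
  field
    order       : ℕ
    .{{nonZero}} : NonZero order
    underlying  : Graph order

open LabelledGraph public

𝔾 : Set
𝔾 = FormalSum LabelledGraph

-- The part of 𝔾 spanned by the graphs with vertex set [n].

𝔾[_] : ℕ → Set
𝔾[ n ] = FormalSum (Graph n)

Ext : ∀ {n N} .{{_ : NonZero N}} → n ℕ.≤ N → 𝔾[ n ] → Graph N → 𝔾
Ext n≤N l G = map (map₂ λ H → labelled _ (G ⊎ᴱ includeEdges n≤N (E H))) l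

-- Formal power series in x₁, x₂, …, given by their coefficients: the vector
-- α : Vector ℕ m is the monomial x₁^α₁ ⋯ xₘ^αₘ.  A monomial has several such
-- representations, which differ by trailing zeros.  The algebra Λ of symmetric
-- functions is a subspace of the series, so the kernel of X is the same whether
-- X is viewed as a map to Λ or to all series.

PowerSeries : Set
PowerSeries = ∀ {m} → Vector ℕ m → ℂ

IsZero : PowerSeries → Set
IsZero F = ∀ {m} (α : Vector ℕ m) → F α ≈ 0ℂ

IsProper : ∀ {n m} → Graph n → (Fin n → Fin m) → Set
IsProper G κ = All (λ (u , v) → κ u ≢ κ v) (E G)

isProper? : ∀ {n m} (G : Graph n) (κ : Fin n → Fin m) → Dec (IsProper G κ)
isProper? G κ = All.all? (λ (u , v) → ¬? (κ u Fin.≟ κ v)) (E G)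

content : ∀ {n m} → (Fin n → Fin m) → Vector ℕ m
content {n} κ j = length (filter (λ v → κ v Fin.≟ j) (allFin n))

hasContent? : ∀ {n m} (α : Vector ℕ m) (κ : Fin n → Fin m) → Dec (∀ j → content κ j ≡ α j)
hasContent? α κ = Fin.all? (λ j → content κ j ℕ.≟ α j)

-- A coloring κ contributes the monomial ∏ᵥ x_{κ(v)}, whose exponents are
-- `content κ`.  If this monomial is x₁^α₁ ⋯ xₘ^αₘ then κ uses only the first m
-- colors, so the coefficient of x₁^α₁ ⋯ xₘ^αₘ is the number of suitable maps
-- Fin n → Fin m; these are enumerated, without repetition, by finToFun.

colorings : ∀ {n m} → Graph n → Vector ℕ m → List (Fin (m ℕ.^ n))
colorings {n} {m} G α = filter
  (λ c → isProper? G (finToFun c) ×-dec hasContent? {n} α (finToFun c))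
  (allFin (m ℕ.^ n))

X-graph : ∀ {n} → Graph n → PowerSeries
X-graph G α = fromℕ (length (colorings G α))

X : 𝔾 → PowerSeries
X l α = linearExtension (λ G → X-graph (underlying G) α) l

Ker-X : 𝔾 → Set
Ker-X l = IsZero (X l)

IsModularRelation : ∀ {n} → 𝔾[ n ] → Set
IsModularRelation {n} l =
  ∀ N .{{_ : NonZero N}} (n≤N : n ℕ.≤ N) (G : Graph N) → Ker-X (Ext n≤N l G)

record SetPartition (n : ℕ) : Set where
  field
    blocks   : List (Subset n)
    nonempty : All Nonempty blocks
    disjoint : AllPairs (λ A B → Empty (A ∩ B)) blocks
    covering : ∀ v → Any (v ∈_) blocks

open SetPartition public

e : ∀ {n} → Graph n → SetPartition n → ℕ
e H π = length (filter
  (λ (u , v) → Any.any? (λ B → (u ∈? B) ×-dec (v ∈? B)) (blocks π)) (E H))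

C : ∀ {n} → 𝔾[ n ] → SetPartition n → ℂ
C l π = linearExtension (λ H → δ (e H π) 0) l

{-# OPTIONS --safe #-}

-- The coefficient of x^α in X(Ext(l;G)) is the sum of C(l;π_κ) over the proper
-- colorings κ of G with content α, where π_κ is the partition of [n] into the
-- color classes of κ.  So the vanishing of all C(l;π) makes l a modular relation.
-- Conversely, given π with k blocks, let G be the complete multipartite graph on
-- [n] with parts the blocks of π and α the content of the coloring by blocks.
-- Every proper coloring of G with k colors has π as its color classes, hence the
-- coefficient is a positive multiple of C(l;π).

module Submission where

open import Defs
open import Algebra.Bundles using (CommutativeMonoid; CommutativeRing)
open import Data.Bool using (if_then_else_)
open import Data.Fin using (Fin; zero; suc; finToFun; funToFin; inject≤; punchOut)
import Data.Fin.Properties as Fin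
open import Data.Fin.Subset using (Subset; _∈_; _∩_; Empty)
open import Data.Fin.Subset.Properties using (_∈?_; nonempty?; x∈p∩q⁺; x∈p∩q⁻)
open import Data.List as List
  using (List; []; _∷_; allFin; cartesianProduct; filter; foldr; length; map)
open import Data.List.Membership.Propositional using (find; lose)
open import Data.List.Membership.Propositional.Properties
  using (∈-allFin; ∈-cartesianProduct⁺; ∈-filter⁺; ∈-filter⁻; ∈-lookup; ∈-tabulate⁺; ∈-tabulate⁻)
open import Data.List.Properties using (filter-none; filter-some)
open import Data.List.Relation.Unary.All as All using (All; []; _∷_)
import Data.List.Relation.Unary.All.Properties as All
open import Data.List.Relation.Unary.AllPairs using (AllPairs; []; _∷_)
import Data.List.Relation.Unary.AllPairs.Properties as AllPairs
open import Data.List.Relation.Unary.Any as Any using (Any)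
open import Data.List.Relation.Unary.Any.Properties using (lookup-index)
open import Data.Nat as ℕ using (ℕ; zero; suc; NonZero)
import Data.Nat.Properties as ℕ
open import Data.Product using (_×_; _,_; ∃; map₂; proj₁; proj₂)
open import Data.Rational as ℚ using (ℚ; 0ℚ; 1ℚ; Positive)
import Data.Rational.Properties as ℚ
import Data.Vec as Vec
import Data.Vec.Properties as Vec
open import Data.Vec.Functional using (Vector)
open import Function using (_∘_)
open import Function.Bundles using (_⇔_; mk⇔; Equivalence)
open import Function.Construct.Composition using (_⇔-∘_)
open import Function.Definitions using (Injective)
open import Level using (0ℓ)
open import Relation.Binary.PropositionalEquality as ≡
  using (_≡_; _≢_; _≗_; refl; cong; subst)
open import Relation.Nullary using (Dec; yes; no; does; ¬?; _×-dec_; contradiction)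
open import Relation.Nullary.Decidable using (does-⇔; dec-true)
open import Relation.Unary using (Decidable)

open Equivalence using (to; from)

-- Set partitions as kernels of maps

SameBlock : ∀ {n} → SetPartition n → Fin n → Fin n → Set
SameBlock π u v = Any (λ B → u ∈ B × v ∈ B) (blocks π)

IsKernel : ∀ {n} {A : Set} → SetPartition n → (Fin n → A) → Set
IsKernel π f = ∀ u v → SameBlock π u v ⇔ f u ≡ f v

-- By the kernel hypothesis, the edges counted by `e H π` are exactly those whose two ends get equal
-- colors under `f`, so a zero count means that no edge is monochromatic.
e≡0⇔IsProper : ∀ {n m} (π : SetPartition n) {f : Fin n → Fin m} → IsKernel π f →
  ∀ H → e H π ≡ 0 ⇔ IsProper H f
e≡0⇔IsProper π {f} ker H = mk⇔ to′ from′
  where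
  sameBlock? : Decidable (λ ((u , v) : _ × _) → SameBlock π u v)
  sameBlock? (u , v) = Any.any? (λ B → (u ∈? B) ×-dec (v ∈? B)) (blocks π)
  to′ : e H π ≡ 0 → IsProper H f
  to′ e≡0 = All.map (λ ¬same → ¬same ∘ from (ker _ _))
    (All.¬Any⇒All¬ (E H) λ any → ℕ.n≮0 (subst (0 ℕ.<_) e≡0 (filter-some sameBlock? any)))
  from′ : IsProper H f → e H π ≡ 0
  from′ proper = cong length (filter-none sameBlock? (All.map (λ f≢ → f≢ ∘ to (ker _ _)) proper))

module _ {n m} (f : Fin n → Fin m) where

  fibre : Fin m → Subset n
  fibre j = Vec.tabulate λ v → does (f v Fin.≟ j)

  ∈-fibre⁺ : ∀ {v j} → f v ≡ j → v ∈ fibre j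
  ∈-fibre⁺ {v} {j} fv≡j = Vec.lookup⇒[]= v (fibre j)
    (≡.trans (Vec.lookup∘tabulate _ v) (dec-true (f v Fin.≟ j) fv≡j))

  ∈-fibre⁻ : ∀ {v j} → v ∈ fibre j → f v ≡ j
  ∈-fibre⁻ {v} {j} v∈
    -- Abstracting the decision together with the proof that its Boolean is `true` makes the `no`
    -- case absurd.
    with f v Fin.≟ j
       | ≡.trans (≡.sym (Vec.lookup∘tabulate (λ v → does (f v Fin.≟ j)) v)) (Vec.[]=⇒lookup v∈)
  ... | yes fv≡j | _ = fv≡j

  -- Colors that `f` does not take have empty fibres, which cannot be blocks; the filter drops them.
  fibres : List (Subset n)
  fibres = filter nonempty? (List.tabulate fibre)

  fibre∈fibres : ∀ v → Any (fibre (f v) ≡_) fibres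
  fibre∈fibres v = ∈-filter⁺ nonempty? (∈-tabulate⁺ (f v)) (v , ∈-fibre⁺ refl)

  fibrePartition : SetPartition n
  fibrePartition = record
    { blocks   = fibres
    ; nonempty = All.all-filter nonempty? (List.tabulate fibre)
    ; disjoint = AllPairs.filter⁺ nonempty? (AllPairs.tabulate⁺ λ i≢j (v , v∈) →
        let v∈i , v∈j = x∈p∩q⁻ _ _ v∈ in i≢j (≡.trans (≡.sym (∈-fibre⁻ v∈i)) (∈-fibre⁻ v∈j)))
    ; covering = λ v → lose (fibre∈fibres v) (∈-fibre⁺ refl)
    }

  fibrePartition-isKernel : IsKernel fibrePartition f
  fibrePartition-isKernel u v = mk⇔ to′ from′
    where
    to′ : SameBlock fibrePartition u v → f u ≡ f v
    to′ same with find same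
    ... | B , B∈ , u∈ , v∈
      with ∈-tabulate⁻ {f = fibre} (proj₁ (∈-filter⁻ nonempty? {xs = List.tabulate fibre} B∈))
    ...   | j , refl = ≡.trans (∈-fibre⁻ u∈) (≡.sym (∈-fibre⁻ v∈))
    from′ : f u ≡ f v → SameBlock fibrePartition u v
    from′ fu≡fv = lose (fibre∈fibres v) (∈-fibre⁺ fu≡fv , ∈-fibre⁺ refl)

disjoint⇒index-unique : ∀ {n} {Bs : List (Subset n)} → AllPairs (λ A B → Empty (A ∩ B)) Bs →
  ∀ {v} i j → v ∈ List.lookup Bs i → v ∈ List.lookup Bs j → i ≡ j
disjoint⇒index-unique (_ ∷ _)  zero    zero    _  _  = refl
disjoint⇒index-unique (d ∷ _)  zero    (suc j) v∈ w∈ =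
  contradiction (_ , x∈p∩q⁺ (v∈ , w∈)) (All.lookup d (∈-lookup j))
disjoint⇒index-unique (d ∷ _)  (suc i) zero    v∈ w∈ =
  contradiction (_ , x∈p∩q⁺ (w∈ , v∈)) (All.lookup d (∈-lookup i))
disjoint⇒index-unique (_ ∷ ds) (suc i) (suc j) v∈ w∈ =
  cong suc (disjoint⇒index-unique ds i j v∈ w∈)

module _ {n} (π : SetPartition n) where

  -- The index is read off the covering witness; `block-unique` shows that the choice of witness is
  -- immaterial.
  block : Fin n → Fin (length (blocks π))
  block v = Any.index (covering π v)

  ∈-block : ∀ v → v ∈ List.lookup (blocks π) (block v)
  ∈-block v = lookup-index (covering π v)

  block-unique : ∀ {v} i → v ∈ List.lookup (blocks π) i → block v ≡ i
  block-unique i v∈ = disjoint⇒index-unique (disjoint π) _ i (∈-block _) v∈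

  block-isKernel : IsKernel π block
  block-isKernel u v = mk⇔
    (λ same → ≡.trans (block-unique (Any.index same) (proj₁ (lookup-index same)))
      (≡.sym (block-unique (Any.index same) (proj₂ (lookup-index same)))))
    (λ eq → lose (∈-lookup (block u))
      (∈-block u , subst (λ i → v ∈ List.lookup (blocks π) i) (≡.sym eq) (∈-block v)))

  -- Nonemptiness of the blocks gives every color a representative, as `finer⇒constantOnParts`
  -- requires.
  block-surjective : ∀ i → ∃ λ v → block v ≡ i
  block-surjective i with All.lookup (nonempty π) (∈-lookup i)
  ... | v , v∈ = v , block-unique i v∈

-- Colorings

-- Pigeonhole: if `j` were missed, punching it out would inject `Fin (suc k)` into `Fin k`.
Fin-injective⇒surjective : ∀ {k} {s : Fin k → Fin k} → Injective _≡_ _≡_ s → ∀ j → ∃ λ i → s i ≡ j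
Fin-injective⇒surjective {zero}      s-inj ()
Fin-injective⇒surjective {suc k} {s} s-inj j with Fin.any? (λ i → s i Fin.≟ j)
... | yes i,si≡j = i,si≡j
... | no  ∄i     = contradiction (Fin.injective⇒≤ {f = λ i → punchOut (j≢s i)} λ eq →
    s-inj (Fin.punchOut-injective (j≢s _) (j≢s _) eq)) (ℕ.<⇒≱ ℕ.≤-refl)
  where
  j≢s : ∀ i → j ≢ s i
  j≢s i j≡si = ∄i (i , ≡.sym j≡si)

-- A coloring finer than p gives the representatives of the k parts different colors,
-- so these are all k colors.
finer⇒constantOnParts : ∀ {n k} {p κ : Fin n → Fin k} → (∀ i → ∃ λ v → p v ≡ i) →
  (∀ {u v} → κ u ≡ κ v → p u ≡ p v) → ∀ {u v} → p u ≡ p v → κ u ≡ κ v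
finer⇒constantOnParts {n} {k} {p} {κ} p-surj finer {u} {v} pu≡pv =
  ≡.trans (κ≡κ∘rep u) (≡.trans (cong (κ ∘ rep) pu≡pv) (≡.sym (κ≡κ∘rep v)))
  where
  rep : Fin k → Fin n
  rep i = proj₁ (p-surj i)
  p∘rep : ∀ i → p (rep i) ≡ i
  p∘rep i = proj₂ (p-surj i)
  κ∘rep-injective : Injective _≡_ _≡_ (κ ∘ rep)
  κ∘rep-injective {i} {j} eq = ≡.trans (≡.sym (p∘rep i)) (≡.trans (finer eq) (p∘rep j))
  κ≡κ∘rep : ∀ u → κ u ≡ κ (rep (p u))
  κ≡κ∘rep u with Fin-injective⇒surjective κ∘rep-injective (κ u)
  ... | i , eq = ≡.trans (≡.sym eq)
    (cong (κ ∘ rep) (≡.trans (≡.sym (p∘rep i)) (finer eq)))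

-- The filter runs over ordered pairs, so each edge occurs in both orientations; properness is
-- unaffected by this repetition.
multipartite : ∀ {n k} → (Fin n → Fin k) → Graph n
multipartite {n} p = graph
  (filter (λ (u , v) → ¬? (p u Fin.≟ p v)) (cartesianProduct (allFin n) (allFin n)))

multipartite-IsProper⁺ : ∀ {n k m} (p : Fin n → Fin k) {κ : Fin n → Fin m} →
  (∀ {u v} → κ u ≡ κ v → p u ≡ p v) → IsProper (multipartite p) κ
multipartite-IsProper⁺ {n} p finer = All.map (λ p≢ κ≡ → p≢ (finer κ≡))
  (All.all-filter (λ (u , v) → ¬? (p u Fin.≟ p v)) (cartesianProduct (allFin n) (allFin n)))

multipartite-IsProper⁻ : ∀ {n k m} (p : Fin n → Fin k) {κ : Fin n → Fin m} →
  IsProper (multipartite p) κ → ∀ {u v} → κ u ≡ κ v → p u ≡ p v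
multipartite-IsProper⁻ p proper {u} {v} κ≡ with p u Fin.≟ p v
... | yes p≡ = p≡
... | no  p≢ = contradiction κ≡ (All.lookup proper (∈-filter⁺ (λ (u , v) → ¬? (p u Fin.≟ p v))
  (∈-cartesianProduct⁺ (∈-allFin u) (∈-allFin v)) p≢))

-- Properness is checked edge by edge. Separating `G` from `H` allows a coloring of `G` to be fixed
-- while `H` varies over the terms of `l`.
IsProper-⊎ᴱ : ∀ {n N m} (n≤N : n ℕ.≤ N) (G : Graph N) (H : Graph n) (κ : Fin N → Fin m) →
  IsProper (G ⊎ᴱ includeEdges n≤N (E H)) κ ⇔
  (IsProper G κ × IsProper H (λ v → κ (inject≤ v n≤N)))
IsProper-⊎ᴱ n≤N G H κ = mk⇔
  (map₂ All.map⁻ ∘ All.++⁻ (E G)) (λ (g , h) → All.++⁺ g (All.map⁺ h))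

-- A proper coloring is finer than `block π`. Since there are as many colors as blocks, it is also
-- constant on blocks, so both maps have the same kernel.
multipartite-isKernel : ∀ {n} (π : SetPartition n) (c : Fin (length (blocks π) ℕ.^ n)) →
  IsProper (multipartite (block π)) (finToFun c) →
  IsKernel π (λ v → finToFun {length (blocks π)} {n} c (inject≤ v ℕ.≤-refl))
multipartite-isKernel {n} π c proper u v
  -- Here `N = n`, and the inclusion of vertices is the identity only up to a propositional
  -- equality.
  rewrite Fin.inject≤-refl u ℕ.≤-refl | Fin.inject≤-refl v ℕ.≤-refl =
  mk⇔ (finer⇒constantOnParts (block-surjective π) finer) finer ⇔-∘ block-isKernel π u v
  where
  finer : ∀ {u v} → finToFun {length (blocks π)} {n} c u ≡ finToFun c v → block π u ≡ block π v
  finer = multipartite-IsProper⁻ (block π) proper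

isColoring? : ∀ {n m} (G : Graph n) (α : Vector ℕ m) →
  Decidable (λ c → IsProper G (finToFun {m} {n} c) × (∀ j → content (finToFun {m} {n} c) j ≡ α j))
isColoring? {n} {m} G α c =
  isProper? G (finToFun {m} {n} c) ×-dec hasContent? α (finToFun {m} {n} c)

module _ {n} (π : SetPartition n) where

  blockGraph : Graph n
  blockGraph = multipartite (block π)

  blockColoring : Fin (length (blocks π) ℕ.^ n)
  blockColoring = funToFin (block π)

  -- Taken of the decoded coloring rather than of `block π`, so that the content condition below
  -- holds by `refl`.
  blockContent : Vector ℕ (length (blocks π))
  blockContent = content (finToFun {_} {n} blockColoring)

  -- This makes the integer factor in front of `C l π` nonzero, hence cancellable.
  blockColoring-exists : 0 ℕ.< length (colorings blockGraph blockContent)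
  blockColoring-exists = filter-some (isColoring? blockGraph blockContent)
    (lose (∈-allFin blockColoring)
      ( multipartite-IsProper⁺ (block π) (λ {u} {v} eq →
          ≡.trans (≡.sym (Fin.finToFun-funToFin (block π) u))
            (≡.trans eq (Fin.finToFun-funToFin (block π) v)))
      , λ _ → refl))

-- Cancelling positive integers in a ring that receives ℚ.

toℚ : ℕ → ℚ
toℚ zero    = 0ℚ
toℚ (suc k) = 1ℚ ℚ.+ toℚ k

toℚ-nonNegative : ∀ k → ℚ.NonNegative (toℚ k)
toℚ-nonNegative zero    = _
toℚ-nonNegative (suc k) = ℚ.nonNeg+nonNeg⇒nonNeg 1ℚ (toℚ k) {{toℚ-nonNegative k}}

toℚ-positive : ∀ k .{{_ : NonZero k}} → Positive (toℚ k)
toℚ-positive (suc k) = ℚ.pos+nonNeg⇒pos 1ℚ (toℚ k) {{toℚ-nonNegative k}}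

-- The argument is carried out over an arbitrary ring R: for R = ℂ, conversion checking
-- would unfold the arithmetic down to Cauchy sequences.

module RingSums (R : CommutativeRing 0ℓ 0ℓ) where
  open CommutativeRing R
    renaming (_≈_ to _≈ᴿ_; _+_ to _+ᴿ_; _*_ to _*ᴿ_; refl to reflᴿ)
  open import Algebra.Properties.CommutativeSemigroup
    (CommutativeMonoid.commutativeSemigroup +-commutativeMonoid) using (interchange)
  open import Algebra.Properties.Semiring.Mult semiring using (×-assoc-*; ×-congʳ)
  open import Algebra.Definitions.RawMonoid +-rawMonoid using () renaming (_×_ to _·ᴿ_)
  open import Relation.Binary.Reasoning.Setoid setoid

  invertible-cancel : ∀ {a z} → (∃ λ w → w *ᴿ a ≈ᴿ 1#) → a *ᴿ z ≈ᴿ 0# → z ≈ᴿ 0#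
  invertible-cancel {a} {z} (w , wa≈1) az≈0 = begin
    z              ≈⟨ *-identityˡ z ⟨
    1# *ᴿ z        ≈⟨ *-congʳ wa≈1 ⟨
    w *ᴿ a *ᴿ z    ≈⟨ *-assoc w a z ⟩
    w *ᴿ (a *ᴿ z)  ≈⟨ *-congˡ az≈0 ⟩
    w *ᴿ 0#        ≈⟨ zeroʳ w ⟩
    0#             ∎

  module _ (ι : ℚ → Carrier)
    (ι-0 : ι 0ℚ ≈ᴿ 0#) (ι-1 : ι 1ℚ ≈ᴿ 1#)
    (ι-+ : ∀ p q → ι (p ℚ.+ q) ≈ᴿ ι p +ᴿ ι q)
    (ι-* : ∀ p q → ι (p ℚ.* q) ≈ᴿ ι p *ᴿ ι q) where

    ×1≈ι : ∀ k → k ·ᴿ 1# ≈ᴿ ι (toℚ k)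
    ×1≈ι zero    = sym ι-0
    ×1≈ι (suc k) = trans (+-cong (sym ι-1) (×1≈ι k)) (sym (ι-+ 1ℚ (toℚ k)))

    -- The map `ι` transports the rational inverse of `k` to an inverse of `k ·ᴿ 1#`, so no division
    -- of arbitrary elements of the ring is required.
    ℚ-algebra-cancel : ∀ k .{{_ : NonZero k}} {z} → (k ·ᴿ 1#) *ᴿ z ≈ᴿ 0# → z ≈ᴿ 0#
    ℚ-algebra-cancel k = invertible-cancel (ι (ℚ.1/ toℚ k) , (begin
      ι (ℚ.1/ toℚ k) *ᴿ (k ·ᴿ 1#)  ≈⟨ *-congˡ (×1≈ι k) ⟩
      ι (ℚ.1/ toℚ k) *ᴿ ι (toℚ k)  ≈⟨ ι-* (ℚ.1/ toℚ k) (toℚ k) ⟨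
      ι (ℚ.1/ toℚ k ℚ.* toℚ k)     ≡⟨ cong ι (ℚ.*-inverseˡ (toℚ k)) ⟩
      ι 1ℚ                         ≈⟨ ι-1 ⟩
      1#                           ∎))
      where instance k≢0 = ℚ.pos⇒nonZero (toℚ k) {{toℚ-positive k}}

  -- Finite sums, linear combinations and indicators.

  ∑ : ∀ {A : Set} → List A → (A → Carrier) → Carrier
  ∑ xs f = foldr (λ x s → f x +ᴿ s) 0# xs

  ∑-const : ∀ {A : Set} (xs : List A) {f : A → Carrier} {z} → All (λ x → f x ≈ᴿ z) xs →
    ∑ xs f ≈ᴿ (length xs ·ᴿ 1#) *ᴿ z
  ∑-const xs {f} {z} f≈z = trans (multiple f≈z) (sym (trans
    (×-assoc-* (length xs) 1# z) (×-congʳ (length xs) (*-identityˡ z))))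
    where
    multiple : ∀ {xs} → All (λ x → f x ≈ᴿ z) xs → ∑ xs f ≈ᴿ length xs ·ᴿ z
    multiple []       = reflᴿ
    multiple (p ∷ ps) = +-cong p (multiple ps)

  linearCombination : ∀ {A : Set} → (A → Carrier) → List (Carrier × A) → Carrier
  linearCombination f = foldr (λ (c , a) s → c *ᴿ f a +ᴿ s) 0#

  module _ {A : Set} where

    linearCombination-cong : ∀ {f g : A → Carrier} → (∀ a → f a ≈ᴿ g a) →
      ∀ l → linearCombination f l ≈ᴿ linearCombination g l
    linearCombination-cong f≈g []            = reflᴿ
    linearCombination-cong f≈g ((c , a) ∷ l) =
      +-cong (*-congˡ (f≈g a)) (linearCombination-cong f≈g l)

    -- The version with `≡` serves the passage between the definitions over ℂ and the generic ones,
    -- which is made by `subst`.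
    linearCombination-≗ : ∀ {f g : A → Carrier} → f ≗ g →
      ∀ l → linearCombination f l ≡ linearCombination g l
    linearCombination-≗ f≗g []            = refl
    linearCombination-≗ f≗g ((c , a) ∷ l) =
      ≡.cong₂ (λ x y → c *ᴿ x +ᴿ y) (f≗g a) (linearCombination-≗ f≗g l)

    linearCombination-map₂ : ∀ {B : Set} (f : B → Carrier) (h : A → B) l →
      linearCombination f (map (map₂ h) l) ≡ linearCombination (f ∘ h) l
    linearCombination-map₂ f h []            = refl
    linearCombination-map₂ f h ((c , a) ∷ l) =
      cong (c *ᴿ f (h a) +ᴿ_) (linearCombination-map₂ f h l)

    linearCombination-0 : ∀ (l : List (Carrier × A)) → linearCombination (λ _ → 0#) l ≈ᴿ 0#
    linearCombination-0 []            = reflᴿ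
    linearCombination-0 ((c , a) ∷ l) =
      trans (+-cong (zeroʳ c) (linearCombination-0 l)) (+-identityˡ 0#)

    linearCombination-+ : ∀ (f g : A → Carrier) l →
      linearCombination (λ a → f a +ᴿ g a) l ≈ᴿ linearCombination f l +ᴿ linearCombination g l
    linearCombination-+ f g []            = sym (+-identityˡ 0#)
    linearCombination-+ f g ((c , a) ∷ l) = trans
      (+-cong (distribˡ c (f a) (g a)) (linearCombination-+ f g l)) (interchange _ _ _ _)

    -- Interchange of summation: for each fixed coloring, the sum over graphs is taken first.
    linearCombination-∑ : ∀ {B : Set} (g : A → B → Carrier) xs l →
      linearCombination (λ a → ∑ xs (g a)) l ≈ᴿ ∑ xs (λ x → linearCombination (λ a → g a x) l)
    linearCombination-∑ g []       l = linearCombination-0 l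
    linearCombination-∑ g (x ∷ xs) l = trans
      (linearCombination-+ (λ a → g a x) (λ a → ∑ xs (g a)) l)
      (+-congˡ (linearCombination-∑ g xs l))

  indicator : ∀ {P : Set} → Dec P → Carrier
  indicator P? = if does P? then 1# else 0#

  indicator-⇔ : ∀ {P Q : Set} → P ⇔ Q → (P? : Dec P) (Q? : Dec Q) →
    indicator P? ≈ᴿ indicator Q?
  indicator-⇔ P⇔Q P? Q? = reflexive (cong (if_then 1# else 0#) (does-⇔ P⇔Q P? Q?))

  -- The condition `Q` moves from the range of the sum into the summand. With `Q` the condition on
  -- `H`, the remaining range is the same for all `H`, so sums can be interchanged.
  length-filter-× : ∀ {A : Set} {P Q R : A → Set} (P? : Decidable P) (Q? : Decidable Q)
    (R? : Decidable R) → (∀ x → R x ⇔ (P x × Q x)) → ∀ xs →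
    length (filter R? xs) ·ᴿ 1# ≈ᴿ ∑ (filter P? xs) (indicator ∘ Q?)
  length-filter-× P? Q? R? R⇔P×Q []       = reflᴿ
  length-filter-× P? Q? R? R⇔P×Q (x ∷ xs) with R? x | P? x
  length-filter-× P? Q? R? R⇔P×Q (x ∷ xs) | yes r | no ¬p =
    contradiction (proj₁ (to (R⇔P×Q x) r)) ¬p
  length-filter-× P? Q? R? R⇔P×Q (x ∷ xs) | no ¬r | no ¬p =
    length-filter-× P? Q? R? R⇔P×Q xs
  length-filter-× P? Q? R? R⇔P×Q (x ∷ xs) | yes r | yes p with Q? x
  ... | yes q = +-congˡ (length-filter-× P? Q? R? R⇔P×Q xs)
  ... | no ¬q = contradiction (proj₂ (to (R⇔P×Q x) r)) ¬q
  length-filter-× P? Q? R? R⇔P×Q (x ∷ xs) | no ¬r | yes p with Q? x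
  ... | yes q = contradiction (from (R⇔P×Q x) (p , q)) ¬r
  ... | no ¬q = trans (length-filter-× P? Q? R? R⇔P×Q xs) (sym (+-identityˡ _))

  -- Coefficients as sums over colorings, and the two implications.

  -- It tests whether every block is a stable set of `H`; over ℂ it unfolds to `δ (e H π) 0`.
  stableIndicator : ∀ {n} → SetPartition n → Graph n → Carrier
  stableIndicator π H = indicator (e H π ℕ.≟ 0)

  stableIndicator-kernel : ∀ {n m} (π : SetPartition n) {f : Fin n → Fin m} → IsKernel π f → ∀ l →
    linearCombination (λ H → indicator (isProper? H f)) l ≈ᴿ linearCombination (stableIndicator π) l
  stableIndicator-kernel π {f} ker = linearCombination-cong λ H →
    sym (indicator-⇔ (e≡0⇔IsProper π ker H) (e H π ℕ.≟ 0) (isProper? H f))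

  coloringCount : ∀ {n N m} → n ℕ.≤ N → Graph N → Vector ℕ m → Graph n → Carrier
  coloringCount n≤N G α H = length (colorings (G ⊎ᴱ includeEdges n≤N (E H)) α) ·ᴿ 1#

  -- Coloring `G` together with `H` means choosing a coloring of `G` with content `α` whose
  -- restriction is proper for `H`. The first choice does not involve `H`, so the sum over the terms
  -- of `l` moves inside.
  coloringCount-∑ : ∀ {n N m} (n≤N : n ℕ.≤ N) l (G : Graph N) (α : Vector ℕ m) →
    linearCombination (coloringCount n≤N G α) l ≈ᴿ ∑ (colorings G α) λ c →
      linearCombination (λ H → indicator (isProper? H (λ v → finToFun {m} {N} c (inject≤ v n≤N)))) l
  coloringCount-∑ {n} {N} {m} n≤N l G α = trans
    (linearCombination-cong (λ H → length-filter-×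
      (isColoring? G α)
      (λ c → isProper? H (λ v → κ c (inject≤ v n≤N)))
      (isColoring? (G ⊎ᴱ includeEdges n≤N (E H)) α)
      -- The content condition is regrouped with properness on `G`, leaving properness on `H` as the
      -- weight.
      (λ c → let eq = IsProper-⊎ᴱ n≤N G H (κ c) in mk⇔
        (λ (p , h) → let g , p′ = to eq p in (g , h) , p′)
        (λ ((g , h) , p′) → from eq (g , p′) , h))
      (allFin (m ℕ.^ N))) l)
    (linearCombination-∑ _ (colorings G α) l)
    where
    κ : Fin (m ℕ.^ N) → Fin N → Fin m
    κ = finToFun

  stable≈0⇒coefficient≈0 : ∀ {n} (l : List (Carrier × Graph n)) →
    (∀ π → linearCombination (stableIndicator π) l ≈ᴿ 0#) →
    ∀ {N m} (n≤N : n ℕ.≤ N) (G : Graph N) (α : Vector ℕ m) →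
    linearCombination (coloringCount n≤N G α) l ≈ᴿ 0#
  stable≈0⇒coefficient≈0 l stable≈0 {N} {m} n≤N G α = begin
    linearCombination (coloringCount n≤N G α) l  ≈⟨ coloringCount-∑ n≤N l G α ⟩
    _                                            ≈⟨ ∑-const (colorings G α) (All.tabulate λ {c} _ →
      -- The restriction of the coloring to the vertices of `l` has its own color classes as kernel
      -- partition, and there the hypothesis applies.
      let f = λ v → finToFun {m} {N} c (inject≤ v n≤N) in
      trans (stableIndicator-kernel (fibrePartition f) (fibrePartition-isKernel f) l)
            (stable≈0 (fibrePartition f))) ⟩
    (length (colorings G α) ·ᴿ 1#) *ᴿ 0#         ≈⟨ zeroʳ _ ⟩
    0#                                           ∎

  -- All colorings counted here have kernel `π`, so all summands agree and the coefficient is their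
  -- number times the common value; `cancel` removes that number.
  coefficient≈0⇒stable≈0 : (∀ k .{{_ : NonZero k}} {z} → (k ·ᴿ 1#) *ᴿ z ≈ᴿ 0# → z ≈ᴿ 0#) →
    ∀ {n} (l : List (Carrier × Graph n)) (π : SetPartition n) →
    linearCombination (coloringCount ℕ.≤-refl (blockGraph π) (blockContent π)) l ≈ᴿ 0# →
    linearCombination (stableIndicator π) l ≈ᴿ 0#
  coefficient≈0⇒stable≈0 cancel l π coefficient≈0 = cancel
    (length (colorings (blockGraph π) (blockContent π)))
    {{ℕ.>-nonZero (blockColoring-exists π)}} (begin
      (length (colorings (blockGraph π) (blockContent π)) ·ᴿ 1#) *ᴿ
        linearCombination (stableIndicator π) l
          ≈⟨ ∑-const (colorings (blockGraph π) (blockContent π)) (All.map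
            (λ {c} (proper , _) → stableIndicator-kernel π (multipartite-isKernel π c proper) l)
            (All.all-filter (isColoring? (blockGraph π) (blockContent π)) (allFin _))) ⟨
      _   ≈⟨ coloringCount-∑ ℕ.≤-refl l (blockGraph π) (blockContent π) ⟨
      linearCombination (coloringCount ℕ.≤-refl (blockGraph π) (blockContent π)) l
          ≈⟨ coefficient≈0 ⟩
      0#  ∎)

-- Specialization to the complex numbers.

open CommutativeRing ℂ-commutativeRing
  using () renaming (refl to ≈-refl)
open Complexification ℝ-commutativeRing using () renaming (_+i_ to _+i≈_)

≈ℝ-pointwise : ∀ {x y} → ℝ.seq x ≗ ℝ.seq y → x ≈ℝ y
≈ℝ-pointwise {x} {y} x≗y = mk≈ (Seq.null-cong
  (λ n → ≡.sym (≡.trans (cong (ℚ._- ℝ.seq y n) (x≗y n)) (ℚ.+-inverseʳ (ℝ.seq y n)))) Seq.null-0)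

ι : ℚ → ℂ
ι q = fromℚ q +i fromℚ 0ℚ

ι-+ : ∀ p q → ι (p ℚ.+ q) ≈ ι p + ι q
ι-+ p q = ≈ℝ-pointwise (λ _ → refl) +i≈ ≈ℝ-pointwise (λ _ → ≡.sym (ℚ.+-identityˡ 0ℚ))

ι-* : ∀ p q → ι (p ℚ.* q) ≈ ι p * ι q
ι-* p q =
  -- In the real part the product of the two zero imaginary parts computes to `0ℚ`, so only the
  -- addition of zero remains.
  ≈ℝ-pointwise (λ _ → ≡.sym (ℚ.+-identityʳ (p ℚ.* q))) +i≈
  ≈ℝ-pointwise (λ _ → ≡.sym (≡.trans
    (≡.cong₂ ℚ._+_ (ℚ.*-zeroʳ p) (ℚ.*-zeroˡ q)) (ℚ.+-identityˡ 0ℚ)))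

ι-0 : ι 0ℚ ≈ 0ℂ
ι-0 = ≈-refl

ι-1 : ι 1ℚ ≈ 1ℂ
ι-1 = ≈-refl

linearExtension≡linearCombination : ∀ {A : Set} (f : A → ℂ) l →
  linearExtension f l ≡ RingSums.linearCombination ℂ-commutativeRing f l
linearExtension≡linearCombination f l = refl

linearExtension-≗ : ∀ {A : Set} {f g : A → ℂ} → f ≗ g →
  ∀ l → linearExtension f l ≡ RingSums.linearCombination ℂ-commutativeRing g l
linearExtension-≗ {f = f} f≗g l = ≡.trans (linearExtension≡linearCombination f l)
  (RingSums.linearCombination-≗ ℂ-commutativeRing f≗g l)

linearExtension-map₂ : ∀ {A B : Set} {f : B → ℂ} {h : A → B} {g : A → ℂ} → f ∘ h ≗ g →
  ∀ l → linearExtension f (map (map₂ h) l) ≡ RingSums.linearCombination ℂ-commutativeRing g l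
linearExtension-map₂ {f = f} {h} fh≗g l = ≡.trans
  (linearExtension≡linearCombination f (map (map₂ h) l))
  (≡.trans (RingSums.linearCombination-map₂ ℂ-commutativeRing f h l)
    (RingSums.linearCombination-≗ ℂ-commutativeRing fh≗g l))

C≡linearCombination : ∀ {n} (l : 𝔾[ n ]) (π : SetPartition n) →
  C l π ≡ RingSums.linearCombination ℂ-commutativeRing
    (RingSums.stableIndicator ℂ-commutativeRing π) l
C≡linearCombination l π = linearExtension-≗ {f = λ H → δ (e H π) 0}
  {g = RingSums.stableIndicator ℂ-commutativeRing π} (λ _ → refl) l

X-Ext≡linearCombination : ∀ {n N m} .{{_ : NonZero N}} (n≤N : n ℕ.≤ N) (l : 𝔾[ n ]) (G : Graph N)
  (α : Vector ℕ m) → X (Ext n≤N l G) α ≡ RingSums.linearCombination ℂ-commutativeRing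
    (RingSums.coloringCount ℂ-commutativeRing n≤N G α) l
X-Ext≡linearCombination n≤N l G α = linearExtension-map₂ {f = λ G → X-graph (underlying G) α}
  {h = λ H → labelled _ (G ⊎ᴱ includeEdges n≤N (E H))}
  {g = RingSums.coloringCount ℂ-commutativeRing n≤N G α} (λ _ → refl) l

C≈0⇒modular : ∀ {n} (l : 𝔾[ n ]) → (∀ π → C l π ≈ 0ℂ) → IsModularRelation l
C≈0⇒modular l C≈0 N n≤N G α = subst (_≈ 0ℂ) (≡.sym (X-Ext≡linearCombination n≤N l G α))
  (RingSums.stable≈0⇒coefficient≈0 ℂ-commutativeRing l
    (λ π → subst (_≈ 0ℂ) (C≡linearCombination l π) (C≈0 π)) n≤N G α)

-- One instance of modularity suffices: `N = n`, which is admissible as `n` is positive, with the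
-- graph and the monomial built from `π`.
modular⇒C≈0 : ∀ {n} .{{_ : NonZero n}} (l : 𝔾[ n ]) → IsModularRelation l → ∀ π → C l π ≈ 0ℂ
modular⇒C≈0 {n} l modular π = subst (_≈ 0ℂ) (≡.sym (C≡linearCombination l π))
  (RingSums.coefficient≈0⇒stable≈0 ℂ-commutativeRing
    (RingSums.ℚ-algebra-cancel ℂ-commutativeRing ι ι-0 ι-1 ι-+ ι-*) l π
    (subst (_≈ 0ℂ) (X-Ext≡linearCombination ℕ.≤-refl l (blockGraph π) (blockContent π))
      (modular n ℕ.≤-refl (blockGraph π) (blockContent π))))

corollary5 : ∀ (n : ℕ) .{{_ : NonZero n}} (l : 𝔾[ n ]) →
    IsModularRelation l ⇔ (∀ (π : SetPartition n) → C l π ≈ 0ℂ)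
corollary5 n l = mk⇔ (modular⇒C≈0 l) (C≈0⇒modular l)
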